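{- The logic $\mathrm{BFL}^\star$ is sensitive to unwinding: there exist a flow network $N$, with unwinding $N_t$, and a closed $\mathrm{BFL}^\star$ state formula $\varphi$ such that it is not the case that ($N\models\varphi$ iff $N_t\models\varphi$).
   Context: **Flow networks.** A flow network is $N=\langle AP,V,E,c,\rho,s,T\rangle$ (finite), where $AP$ is a set of atomic propositions, $V$ is a set of vertices, $s\in V$ is the source, $T\subseteq V\setminus\{s\}$ is a set of target vertices, $E\subseteq (V\setminus T)\times(V\setminus\{s\})$ is a set of directed edges, $c:E\to\mathbb{N}$ is a capacity function, and $\rho:V\to 2^{AP}$ labels vertices. All $t\in T$ are assumed reachable from $s$, and each vertex has at least one target reachable from it. Let $E^u$ and $E_u$ be the sets of edges entering and leaving $u$. A flow function is $f:E\to\mathbb{N}$ with $f(e)\le c(e)$ for all $e\in E$ and $\sum_{e\in E^v}f(e)=\sum_{e\in E_v}f(e)$ for all $v\in V\setminus(\{s\}\cup T)$. The flow in a vertex is $f(v)=\sum_{e\in E^v}f(e)$ for $v\neq s$ and $f(s)=\sum_{e\in E_s}f(e)$. **Unwinding.** The unwinding of $N$ is the tree-shaped network $N_t=\langle AP,V',E',c',\rho',s,T'\rangle$, where $V'\subseteq V^*$ is the smallest set such that $s\in V'$ and, whenever $w\cdot v\in V'$ with $w\in V^*$, $v\in V\setminus T$, and $\langle v,u\rangle\in E$, then $w\cdot v\cdot u\in V'$, with $\rho'(w\cdot v\cdot u)=\rho(u)$; moreover $\langle w\cdot v,w\cdot v\cdot u\rangle\in E'$ with $c'(\langle w\cdot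 v,w\cdot v\cdot u\rangle)=c(\langle v,u\rangle)$; and $T'=V'\cap(V^*\cdot T)$. ($\rho'(s)=\rho(s)$. $N_t$ may be infinite; flow functions and satisfaction in $N_t$ are defined by the same clauses.) **Syntax of $\mathrm{BFL}^\star$.** State formulas: $p\in AP$; flow propositions $>\gamma$ and $\geq\gamma$ for $\gamma\in\mathbb{N}$; $\neg\varphi_1$, $\varphi_1\vee\varphi_2$ for state formulas $\varphi_1,\varphi_2$; $A\psi$ for a path formula $\psi$; $\mathcal{A}\varphi$ for a state formula $\varphi$ ($\mathcal{A}$ is the flow quantifier). Path formulas: state formulas; $\neg\psi_1$, $\psi_1\vee\psi_2$, $X\psi_1$, $\psi_1U\psi_2$ for path formulas $\psi_1,\psi_2$. A formula is closed if all its flow propositions are in the scope of a flow quantifier. **Semantics.** For $u\in V$, a target $u$-path is a finite path $v_0,\dots,v_k$ in $(V,E)$ with $v_0=u$, $v_k\in T$; $\pi^i$ denotes the suffix $v_i,\dots,v_k$. State formulas: $v,f\models p$ iff $p\in\rho(v)$; $v,f\models{>}\gamma$ iff $f(v)>\gamma$; $v,f\models{\geq}\gamma$ iff $f(v)\ge\gamma$; Boolean operators as usual; $v,f\models A\psi$ iff $\pi,f\models\psi$ for all target $v$-paths $\pi$; $v,f\models\mathcal{A}\varphi$ iff $v,f'\models\varphi$ for all flow functions $f'$. Path formulas, $\pi=v_0,\dots,v_k$: $\pi,f\models\varphi$ iff $v_0,f\models\varphi$ for a state formula $\varphi$; Boolean operators as usual; $\pi,f\models X\psi$ iff $k>0$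 and $\pi^1,f\models\psi$; $\pi,f\models\psi_1U\psi_2$ iff there is $j\le k$ with $\pi^j,f\models\psi_2$ and $\pi^i,f\models\psi_1$ for all $0\le i<j$. For closed $\varphi$, $N\models\varphi$ iff $s\models\varphi$ (the flow function is irrelevant). -}

module Defs where

open import Data.Empty using (⊥; ⊥-elim-irr)
open import Data.Fin.Base using (Fin)
open import Data.Fin.Subset using (Subset) renaming (_∈_ to _∈ˢ_)
open import Data.Irrelevant using ([_])
open import Data.List.Base using (List; []; _∷_; map)
import Data.List.Properties as List
open import Data.List.Membership.Propositional using (_∈_)
open import Data.List.Membership.Propositional.Properties using (∈-map⁺)
open import Data.List.NonEmpty.Base using (List⁺; _∷_; head; toList)
open import Data.List.Relation.Unary.All using ([])
open import Data.List.Relation.Unary.AllPairs using ([]; _∷_)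
open import Data.List.Relation.Unary.Any using (here)
open import Data.List.Relation.Unary.Unique.Propositional using (Unique)
open import Data.List.Relation.Unary.Unique.Propositional.Properties using (map⁺)
open import Data.Nat.Base using (ℕ; zero; suc; _≤_; _<_; _≥_; _>_; z≤n; s≤s⁻¹)
open import Data.Nat.ListAction using (sum)
open import Data.Product.Base using (∃; Σ-syntax; ∃-syntax; _×_; _,_; proj₁; proj₂)
open import Data.Refinement using (Refinement-syntax; value; _,_; value-injective)
open import Data.Sum.Base using (_⊎_)
import Data.Sum.Base as Sum
open import Data.Unit.Base using (⊤)
open import Function.Base using (_∘_)
open import Function.Bundles using (_↔_)
open import Relation.Binary.Construct.Closure.ReflexiveTransitive using (Star)
open import Relation.Binary.Definitions using (DecidableEquality)
open import Relation.Binary.PropositionalEquality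
  using (_≡_; _≢_; refl; sym; cong; trans; subst)
open import Relation.Nullary using (¬_; yes; no; recompute)
open import Relation.Nullary.Decidable using (map′; _×-dec_)

-- A labelled, capacitated graph with source and targets, not necessarily
-- finite, but with finitely many edges entering and leaving each vertex, so
-- that flow has the same definition in a finite network and in its unwinding.
-- The set of atomic propositions is Fin k.  Edge, In v and Out v carry the
-- proof of E irrelevantly, making Edge a genuine subset of V × V.
record Network (k : ℕ) : Set₁ where
  field
    V   : Set
    _≟_ : DecidableEquality V
    E   : V → V → Set

  Edge : Set
  Edge = [ e ∈ V × V ∣ E (proj₁ e) (proj₂ e) ]

  In : V → Set
  In v = [ u ∈ V ∣ E u v ]

  Out : V → Set
  Out v = [ u ∈ V ∣ E v u ]

  field
    c : Edge → ℕ
    ρ : V → Subset k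
    s : V
    T : V → Set

    in-edges     : ∀ v → List (In v)
    in-unique    : ∀ v → Unique (in-edges v)
    in-complete  : ∀ v (e : In v) → e ∈ in-edges v
    out-edges    : ∀ v → List (Out v)
    out-unique   : ∀ v → Unique (out-edges v)
    out-complete : ∀ v (e : Out v) → e ∈ out-edges v

record FlowNetwork (k : ℕ) : Set₁ where
  field
    network : Network k

  open Network network public

  field
    finite            : ∃[ n ] (V ↔ Fin n)
    s∉T               : ¬ T s
    E-leaves-non-T    : ∀ {u v} → E u v → ¬ T u
    E-enters-non-s    : ∀ {u v} → E u v → v ≢ s
    targets-reachable : ∀ t → T t → Star E s t
    reaches-target    : ∀ v → ∃[ t ] (T t × Star E v t)

------------------------------------------------------------------------
-- Flow functions and target paths

module _ {k : ℕ} (N : Network k) where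
  open Network N

  inflow outflow : (Edge → ℕ) → V → ℕ
  inflow  f v = sum (map (λ (u , p) → f ((u , v) , p)) (in-edges v))
  outflow f v = sum (map (λ (u , p) → f ((v , u) , p)) (out-edges v))

  record Flow : Set where
    field
      flow         : Edge → ℕ
      capacity     : ∀ e → flow e ≤ c e
      conservation : ∀ v → v ≢ s → ¬ T v → inflow flow v ≡ outflow flow v

  flowAt : Flow → V → ℕ
  flowAt f v with v ≟ s
  ... | yes _ = outflow (Flow.flow f) v
  ... | no  _ = inflow (Flow.flow f) v

  data TargetPath : V → Set where
    stop : ∀ {v} → T v → TargetPath v
    step : ∀ {u v} → E u v → TargetPath v → TargetPath u

-- The number of edges, i.e. k for a path v₀ , … , vₖ.
length : ∀ {k} {N : Network k} {v} → TargetPath N v → ℕ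
length (stop _)   = zero
length (step _ π) = suc (length π)

suffix : ∀ {k} {N : Network k} {v} (π : TargetPath N v) (i : ℕ) →
         i ≤ length π → ∃[ vᵢ ] TargetPath N vᵢ
suffix π          zero    _       = _ , π
suffix (step _ π) (suc i) 1+i≤1+k = suffix π i (s≤s⁻¹ 1+i≤1+k)

------------------------------------------------------------------------
-- The logic BFL⋆

data PathFormula (k : ℕ) : Set

infixr 6 _∨ˢ_ _∨ᵖ_
infixr 7 _U_
infix  8 ¬ˢ_ ¬ᵖ_

data StateFormula (k : ℕ) : Set where
  atom        : Fin k → StateFormula k
  flow> flow≥ : ℕ → StateFormula k
  ¬ˢ_         : StateFormula k → StateFormula k
  _∨ˢ_        : StateFormula k → StateFormula k → StateFormula k
  A           : PathFormula k → StateFormula k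
  𝒜           : StateFormula k → StateFormula k

data PathFormula k where
  state : StateFormula k → PathFormula k
  ¬ᵖ_   : PathFormula k → PathFormula k
  _∨ᵖ_  : PathFormula k → PathFormula k → PathFormula k
  X     : PathFormula k → PathFormula k
  _U_   : PathFormula k → PathFormula k → PathFormula k

mutual
  Closed : ∀ {k} → StateFormula k → Set
  Closed (atom _)   = ⊤
  Closed (flow> _)  = ⊥
  Closed (flow≥ _)  = ⊥
  Closed (¬ˢ φ)     = Closed φ
  Closed (φ₁ ∨ˢ φ₂) = Closed φ₁ × Closed φ₂
  Closed (A ψ)      = Closedᵖ ψ
  Closed (𝒜 _)      = ⊤

  Closedᵖ : ∀ {k} → PathFormula k → Set
  Closedᵖ (state φ)  = Closed φ
  Closedᵖ (¬ᵖ ψ)     = Closedᵖ ψ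
  Closedᵖ (ψ₁ ∨ᵖ ψ₂) = Closedᵖ ψ₁ × Closedᵖ ψ₂
  Closedᵖ (X ψ)      = Closedᵖ ψ
  Closedᵖ (ψ₁ U ψ₂)  = Closedᵖ ψ₁ × Closedᵖ ψ₂

module Semantics {k : ℕ} (N : Network k) where
  open Network N

  mutual
    infix 4 _,_⊨ˢ_ _,_⊨ᵖ_

    _,_⊨ˢ_ : V → Flow N → StateFormula k → Set
    v , f ⊨ˢ atom p   = p ∈ˢ ρ v
    v , f ⊨ˢ flow> γ  = flowAt N f v > γ
    v , f ⊨ˢ flow≥ γ  = flowAt N f v ≥ γ
    v , f ⊨ˢ ¬ˢ φ     = ¬ (v , f ⊨ˢ φ)
    v , f ⊨ˢ φ₁ ∨ˢ φ₂ = (v , f ⊨ˢ φ₁) ⊎ (v , f ⊨ˢ φ₂)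
    v , f ⊨ˢ A ψ      = (π : TargetPath N v) → (v , π) , f ⊨ᵖ ψ
    v , f ⊨ˢ 𝒜 φ      = (f′ : Flow N) → v , f′ ⊨ˢ φ

    _,_⊨ᵖ_ : ∃[ v ] TargetPath N v → Flow N → PathFormula k → Set
    (v , π) , f ⊨ᵖ state φ  = v , f ⊨ˢ φ
    π       , f ⊨ᵖ ¬ᵖ ψ     = ¬ (π , f ⊨ᵖ ψ)
    π       , f ⊨ᵖ ψ₁ ∨ᵖ ψ₂ = (π , f ⊨ᵖ ψ₁) ⊎ (π , f ⊨ᵖ ψ₂)
    (_ , π) , f ⊨ᵖ X ψ      = Σ[ k>0 ∈ length π > 0 ] suffix π 1 k>0 , f ⊨ᵖ ψ
    (_ , π) , f ⊨ᵖ ψ₁ U ψ₂  =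
      ∃[ j ] Σ[ j≤k ∈ j ≤ length π ]
        (suffix π j j≤k , f ⊨ᵖ ψ₂) ×
        (∀ i (i≤k : i ≤ length π) → i < j → suffix π i i≤k , f ⊨ᵖ ψ₁)

  -- The flow function is irrelevant to closed formulas, which is what makes
  -- quantifying over it in _⊨_ below harmless; a flow function always exists.
  mutual
    closed-irrelevant : ∀ φ → Closed φ → ∀ {v} f f′ → v , f ⊨ˢ φ → v , f′ ⊨ˢ φ
    closed-irrelevant (atom _)   _         f f′ h   = h
    closed-irrelevant (¬ˢ φ)     cl        f f′ h   = h ∘ closed-irrelevant φ cl f′ f
    closed-irrelevant (φ₁ ∨ˢ φ₂) (cl₁ , cl₂) f f′ =
      Sum.map (closed-irrelevant φ₁ cl₁ f f′) (closed-irrelevant φ₂ cl₂ f f′)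
    closed-irrelevant (A ψ)      cl        f f′ h π = closed-irrelevantᵖ ψ cl f f′ (h π)
    closed-irrelevant (𝒜 _)      _         f f′ h   = h

    closed-irrelevantᵖ : ∀ ψ → Closedᵖ ψ → ∀ {π} f f′ → π , f ⊨ᵖ ψ → π , f′ ⊨ᵖ ψ
    closed-irrelevantᵖ (state φ)  cl          f f′ = closed-irrelevant φ cl f f′
    closed-irrelevantᵖ (¬ᵖ ψ)     cl          f f′ h = h ∘ closed-irrelevantᵖ ψ cl f′ f
    closed-irrelevantᵖ (ψ₁ ∨ᵖ ψ₂) (cl₁ , cl₂) f f′ =
      Sum.map (closed-irrelevantᵖ ψ₁ cl₁ f f′) (closed-irrelevantᵖ ψ₂ cl₂ f f′)
    closed-irrelevantᵖ (X ψ)      cl          f f′ (p , h) =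
      p , closed-irrelevantᵖ ψ cl f f′ h
    closed-irrelevantᵖ (ψ₁ U ψ₂)  (cl₁ , cl₂) f f′ (j , p , h₂ , h₁) =
      j , p , closed-irrelevantᵖ ψ₂ cl₂ f f′ h₂ ,
      λ i q i<j → closed-irrelevantᵖ ψ₁ cl₁ f f′ (h₁ i q i<j)

  zero-flow : Flow N
  zero-flow = record
    { flow         = λ _ → 0
    ; capacity     = λ _ → z≤n
    ; conservation = λ v _ _ → trans (sum-zero (in-edges v)) (sym (sum-zero (out-edges v)))
    }
    where
    sum-zero : ∀ {B : Set} (xs : List B) → sum (map (λ _ → 0) xs) ≡ 0
    sum-zero []       = refl
    sum-zero (_ ∷ xs) = sum-zero xs

infix 4 _⊨_
_⊨_ : ∀ {k} → Network k → StateFormula k → Set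
N ⊨ φ = (f : Flow N) → Network.s N , f ⊨ˢ φ
  where open Semantics N

------------------------------------------------------------------------
-- Unwinding

module Unwinding {k : ℕ} (N : FlowNetwork k) where
  open FlowNetwork N

  -- Words are written last letter first: w · v · u is u ∷ v ∷ w.
  data InV′ : List⁺ V → Set where
    root   : InV′ (s ∷ [])
    extend : ∀ {w v u} → InV′ (v ∷ w) → ¬ T v → E v u → InV′ (u ∷ v ∷ w)

  V′ : Set
  V′ = [ w ∈ List⁺ V ∣ InV′ w ]

  last : V′ → V
  last x = head (value x)

  data E′ : V′ → V′ → Set where
    edge : ∀ {w v u} (m : InV′ (v ∷ w)) (v∉T : ¬ T v) (e : E v u) →
           E′ ((v ∷ w) , [ m ]) ((u ∷ v ∷ w) , [ extend m v∉T e ])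

  underlying : ∀ {x y} → E′ x y → E (last x) (last y)
  underlying (edge _ _ e) = e

  _≟ʷ_ : DecidableEquality (List⁺ V)
  (a ∷ as) ≟ʷ (b ∷ bs) =
    map′ (λ { (refl , refl) → refl }) (λ { refl → refl , refl })
         ((a ≟ b) ×-dec List.≡-dec _≟_ as bs)

  _≟′_ : DecidableEquality V′
  x ≟′ y = map′ value-injective (cong value) (value x ≟ʷ value y)

  init∈V′ : ∀ {w v u} → InV′ (u ∷ v ∷ w) → InV′ (v ∷ w)
  init∈V′ (extend m _ _) = m

  last-edge : ∀ {w v u} (m : InV′ (u ∷ v ∷ w)) →
              E′ ((v ∷ w) , [ init∈V′ m ]) ((u ∷ v ∷ w) , [ m ])
  last-edge (extend m v∉T e) = edge m v∉T e

  in-edges′ : ∀ y → List [ x ∈ V′ ∣ E′ x y ]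
  in-edges′ ((_ ∷ [])    , _)     = []
  in-edges′ ((_ ∷ v ∷ w) , [ m ]) = (((v ∷ w) , [ init∈V′ m ]) , [ last-edge m ]) ∷ []

  in-unique′ : ∀ y → Unique (in-edges′ y)
  in-unique′ ((_ ∷ [])    , _) = []
  in-unique′ ((_ ∷ _ ∷ _) , _) = [] ∷ []

  no-edge-to-root : ∀ {x u p} → ¬ E′ x ((u ∷ []) , p)
  no-edge-to-root ()

  source-word : ∀ {x u v w p} → E′ x ((u ∷ v ∷ w) , p) → value x ≡ (v ∷ w)
  source-word (edge _ _ _) = refl

  in-complete′ : ∀ y (e : [ x ∈ V′ ∣ E′ x y ]) → e ∈ in-edges′ y
  in-complete′ ((_ ∷ [])    , _) (_ , [ e ]) = ⊥-elim-irr (no-edge-to-root e)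
  in-complete′ ((_ ∷ v ∷ w) , _) (x , [ e ]) =
    here (value-injective (value-injective
      (recompute (value x ≟ʷ (v ∷ w)) (source-word e))))

  child : ∀ x → Out (last x) → [ y ∈ V′ ∣ E′ x y ]
  child ((v ∷ w) , [ m ]) (u , [ e ]) =
    ((u ∷ v ∷ w) , [ extend m (E-leaves-non-T e) e ]) , [ edge m (E-leaves-non-T e) e ]

  child-injective : ∀ x {e e′} → child x e ≡ child x e′ → e ≡ e′
  child-injective x eq = value-injective (cong (last ∘ value) eq)

  out-edges′ : ∀ x → List [ y ∈ V′ ∣ E′ x y ]
  out-edges′ x = map (child x) (out-edges (last x))

  target-word : ∀ {x y} → E′ x y → value y ≡ last y ∷ toList (value x)
  target-word (edge _ _ _) = refl

  out-complete′ : ∀ x (e : [ y ∈ V′ ∣ E′ x y ]) → e ∈ out-edges′ x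
  out-complete′ x (y , [ e ]) =
    subst (_∈ out-edges′ x)
          (value-injective (value-injective
            (sym (recompute (value y ≟ʷ (last y ∷ toList (value x))) (target-word e)))))
          (∈-map⁺ (child x) (out-complete (last x) (last y , [ underlying e ])))

  c′ : [ e ∈ V′ × V′ ∣ E′ (proj₁ e) (proj₂ e) ] → ℕ
  c′ ((x , y) , [ e ]) = c ((last x , last y) , [ underlying e ])

  unwinding : Network k
  unwinding = record
    { V            = V′
    ; _≟_          = _≟′_
    ; E            = E′
    ; c            = c′
    ; ρ            = ρ ∘ last
    ; s            = (s ∷ []) , [ root ]
    ; T            = T ∘ last
    ; in-edges     = in-edges′
    ; in-unique    = in-unique′
    ; in-complete  = in-complete′
    ; out-edges    = out-edges′
    ; out-unique   = λ x → map⁺ (child-injective x) (out-unique (last x))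
    ; out-complete = out-complete′
    }

open Unwinding using (unwinding) public

{-# OPTIONS --safe #-}

-- Take the network with edges s → a, s → t and a → t, all of capacity 1, and
-- target t.  The unit flow sends 2 into t, a successor of s.  In the unwinding
-- the words s·t and s·a·t are different vertices, and since a vertex of a tree
-- has a single incoming edge, no successor of the root receives more than 1.
-- So "under every flow, no successor of the source has flow > 1" tells the two
-- networks apart.

module Submission where

open import Data.Fin.Base using (Fin)
open import Data.Fin.Patterns using (0F; 1F; 2F)
import Data.Fin.Properties as Fin
open import Data.Fin.Subset using () renaming (⊥ to ∅)
open import Data.Irrelevant using ([_])
open import Data.List.Base using (List; []; _∷_)
open import Data.List.Membership.Propositional using (_∈_)
open import Data.List.Relation.Unary.All using ([]; _∷_)
open import Data.List.Relation.Unary.AllPairs using ([]; _∷_)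
open import Data.List.Relation.Unary.Any using (here; there)
open import Data.List.Relation.Unary.Unique.Propositional using (Unique)
open import Data.Nat.Base using (_≤_; z≤n; s≤s)
open import Data.Nat.Properties using (+-identityʳ; ≤-refl; ≤-trans; ≤-reflexive; ≤⇒≯)
open import Data.Product.Base using (∃-syntax; Σ-syntax; _×_; _,_)
open import Data.Refinement using (Refinement-syntax; _,_)
open import Data.Unit.Base using (tt)
open import Function.Bundles using (_⇔_; Equivalence)
open import Function.Construct.Identity using (↔-id)
open import Relation.Binary.Construct.Closure.ReflexiveTransitive using (Star; ε; _◅_)
open import Relation.Binary.PropositionalEquality using (_≡_; _≢_; refl)
open import Relation.Nullary using (¬_; yes; no; contradiction)
open import Defs

module _ {k} (N : Network k) (f : Flow N) where
  open Network N

  -- Settles the case split inside `flowAt` from a proof of `v ≢ s`, since the equality test need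
  -- not reduce on words over an abstract vertex type.
  flowAt-inflow : ∀ {v} → v ≢ s → flowAt N f v ≡ inflow N (Flow.flow f) v
  flowAt-inflow {v} v≢s with v ≟ s
  ... | yes v≡s = contradiction v≡s v≢s
  ... | no  _   = refl

module _ {k} (N : FlowNetwork k) where
  open Unwinding N using (E′; edge; c′)

  -- Matching on `edge` exposes a word of at least two letters, so its list of incoming edges
  -- reduces to that one edge.
  unwinding-flowAt≤c : (f : Flow (unwinding N)) → ∀ {x y} (e : E′ x y) →
                       flowAt (unwinding N) f y ≤ c′ ((x , y) , [ e ])
  unwinding-flowAt≤c f (edge _ _ _) =
    -- `λ ()` works because the root has only one letter. The inflow is then the flow of the single
    -- edge plus `0`.
    ≤-trans (≤-reflexive (flowAt-inflow (unwinding N) f λ ()))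
      (≤-trans (≤-reflexive (+-identityʳ _)) (Flow.capacity f _))

pattern source = 0F
pattern middle = 1F
pattern target = 2F

data _⟶_ : Fin 3 → Fin 3 → Set where
  s⟶a : source ⟶ middle
  s⟶t : source ⟶ target
  a⟶t : middle ⟶ target

private
  predecessors : ∀ v → List [ u ∈ Fin 3 ∣ u ⟶ v ]
  predecessors source = []
  predecessors middle = (source , [ s⟶a ]) ∷ []
  predecessors target = (source , [ s⟶t ]) ∷ (middle , [ a⟶t ]) ∷ []

  predecessors-unique : ∀ v → Unique (predecessors v)
  predecessors-unique source = []
  predecessors-unique middle = [] ∷ []
  predecessors-unique target = ((λ ()) ∷ []) ∷ [] ∷ []

  -- Edge proofs are irrelevant, so `refl` identifies two entries once their vertices agree.
  predecessors-complete : ∀ v (e : [ u ∈ Fin 3 ∣ u ⟶ v ]) → e ∈ predecessors v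
  predecessors-complete source (source , [ () ])
  predecessors-complete source (middle , [ () ])
  predecessors-complete source (target , [ () ])
  predecessors-complete middle (source , _) = here refl
  predecessors-complete middle (middle , [ () ])
  predecessors-complete middle (target , [ () ])
  predecessors-complete target (source , _) = here refl
  predecessors-complete target (middle , _) = there (here refl)
  predecessors-complete target (target , [ () ])

  successors : ∀ v → List [ u ∈ Fin 3 ∣ v ⟶ u ]
  successors source = (middle , [ s⟶a ]) ∷ (target , [ s⟶t ]) ∷ []
  successors middle = (target , [ a⟶t ]) ∷ []
  successors target = []

  successors-unique : ∀ v → Unique (successors v)
  successors-unique source = ((λ ()) ∷ []) ∷ [] ∷ []
  successors-unique middle = [] ∷ []
  successors-unique target = []

  successors-complete : ∀ v (e : [ u ∈ Fin 3 ∣ v ⟶ u ]) → e ∈ successors v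
  successors-complete source (source , [ () ])
  successors-complete source (middle , _) = here refl
  successors-complete source (target , _) = there (here refl)
  successors-complete middle (source , [ () ])
  successors-complete middle (middle , [ () ])
  successors-complete middle (target , _) = here refl
  successors-complete target (source , [ () ])
  successors-complete target (middle , [ () ])
  successors-complete target (target , [ () ])

triangle : Network 0
triangle = record
  { V            = Fin 3
  ; _≟_          = Fin._≟_
  ; E            = _⟶_
  ; c            = λ _ → 1
  ; ρ            = λ _ → ∅
  ; s            = source
  ; T            = _≡ target
  ; in-edges     = predecessors
  ; in-unique    = predecessors-unique
  ; in-complete  = predecessors-complete
  ; out-edges    = successors
  ; out-unique   = successors-unique
  ; out-complete = successors-complete
  }

triangle-flowNetwork : FlowNetwork 0
triangle-flowNetwork = record
  { network           = triangle
  ; finite            = 3 , ↔-id (Fin 3)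
  ; s∉T               = λ ()
  ; E-leaves-non-T    = λ { s⟶a () ; s⟶t () ; a⟶t () }
  ; E-enters-non-s    = λ { s⟶a () ; s⟶t () ; a⟶t () }
  ; targets-reachable = λ { _ refl → s⟶t ◅ ε }
  ; reaches-target    = λ v → target , refl , to-target v
  }
  where
  to-target : ∀ v → Star _⟶_ v target
  to-target source = s⟶t ◅ ε
  to-target middle = a⟶t ◅ ε
  to-target target = ε

unit-flow : Flow triangle
unit-flow = record
  { flow         = λ _ → 1
  ; capacity     = λ _ → ≤-refl
  ; conservation = λ where
      source v≢s _   → contradiction refl v≢s
      -- The only vertex that must conserve flow: 1 enters and 1 leaves.
      middle _   _   → refl
      target _   v∉T → contradiction refl v∉T
  }

-- The outer `𝒜` closes the formula. With `A` over `¬ᵖ X`, one flow and one path suffice to refute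
-- it.
successor-flow≤1 : StateFormula 0
successor-flow≤1 = 𝒜 (A (¬ᵖ X (state (flow> 1))))

triangle⊭ : ¬ (triangle ⊨ successor-flow≤1)
triangle⊭ h =
  -- The first flow is the one that `_⊨_` ranges over, the second instantiates `𝒜`. The last
  -- component is `2 > 1`, as both edges into `target` carry 1.
  h unit-flow unit-flow (step s⟶t (stop refl)) (s≤s z≤n , s≤s (s≤s z≤n))

unwinding⊨ : unwinding triangle-flowNetwork ⊨ successor-flow≤1
-- Every path takes a step, as the root is not a target, and its first edge has capacity 1.
unwinding⊨ _ f (step e _) (_ , flow>1) =
  ≤⇒≯ (unwinding-flowAt≤c triangle-flowNetwork f e) flow>1

corollary3p3 : ∃[ k ] Σ[ N ∈ FlowNetwork k ] Σ[ φ ∈ StateFormula k ]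
    (Closed φ × ¬ ((FlowNetwork.network N ⊨ φ) ⇔ (unwinding N ⊨ φ)))
corollary3p3 =
  0 , triangle-flowNetwork , successor-flow≤1 , tt ,
  -- The direction that fails is from the unwinding to the network.
  λ eqv → triangle⊭ (Equivalence.from eqv unwinding⊨)
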